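{- Let $\mathbb{M} = \langle W, \{\sim_i\}_{i \in G}, \{\leq_{i,w}\}_{i \in G}^{w \in W}, V\rangle$ and $\mathbb{M}' = \langle W', \{\sim'_i\}_{i \in G}, \{\leq'_{i,w'}\}_{i \in G}^{w' \in W'}, V'\rangle$ be epistemic plausibility models and let $Z \subseteq W \times W'$ be a relation. 1. If $Z$ is a $K$-bisimulation, then for all $\varphi \in \mathcal{L}(K)$ and all $(w,w') \in Z$: $\mathbb{M}, w \models \varphi \Leftrightarrow \mathbb{M}', w' \models \varphi$. 2. If $Z$ is a $B^+$-bisimulation, then for all $\varphi \in \mathcal{L}(B^+)$ and all $(w,w') \in Z$: $\mathbb{M}, w \models \varphi \Leftrightarrow \mathbb{M}', w' \models \varphi$. 3. If $Z$ is a $B^c$-bisimulation, then for all $\varphi \in \mathcal{L}(B^c)$ and all $(w,w') \in Z$: $\mathbb{M}, w \models \varphi \Leftrightarrow \mathbb{M}', w' \models \varphi$.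
   Context: Fix a non-empty set $G$ of agents and a countably infinite set $Prop$ of proposition letters. Models. An epistemic plausibility model is a structure $\mathbb{M} = \langle W, \{\sim_i\}_{i \in G}, \{\leq_{i,w}\}_{i \in G}^{w \in W}, V\rangle$ where $W$ is a non-empty set of states, each $\sim_i \subseteq W\times W$ is an equivalence relation, each $\leq_{i,w} \subseteq W \times W$ is a well-founded pre-order, and $V : Prop \to \wp(W)$. For $X \subseteq W$, $\mathrm{Min}_{\leq_{i,w}}(X) := \{x \in X \mid \forall y \in X: y \leq_{i,w} x \Rightarrow x \leq_{i,w} y\}$. A well-founded pre-order is a reflexive transitive relation (not necessarily total) such that $\mathrm{Min}_{\leq_{i,w}}(X) \neq \emptyset$ for every non-empty $X \subseteq W$. Write $[w]_{\sim_i} := \{v \in W \mid w \sim_i v\}$. Languages. $\mathcal{L}(K)$ is built from proposition letters $p \in Prop$ using $\neg$, $\wedge$ and the unary operators $K_i$ ($i \in G$); $\mathcal{L}(B^+)$ uses $\neg,\wedge$ and the unary operators $B_i^+$; $\mathcal{L}(B^c)$ uses $\neg,\wedge$ and the binary operators $B_i^{\alpha}\varphi$ ($\alpha,\varphi$ both formulas of the language). Semantics. Proposition letters (via $V$) and Booleans as usual; $[\![\alpha]\!]^{\mathbb{M}} := \{w \in W \mid \mathbb{M},w\models\alpha\}$; $\mathbb{M},w \models K_i\varphi$ iff $\forall v \in [w]_{\sim_i}: \mathbb{M},v\models\varphi$; $\mathbb{M},w \models B_i^\alpha\varphi$ iff $\forall v \in \mathrm{Min}_{\leq_{i,w}}([\![\alpha]\!]^{\mathbb{M}}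 \cap [w]_{\sim_i}): \mathbb{M},v\models\varphi$; $\mathbb{M},w \models B_i^+\varphi$ iff $\forall v \in [w]_{\sim_i}: v \leq_{i,w} w \Rightarrow \mathbb{M},v\models\varphi$. Bisimulations. Let $Z \subseteq W\times W'$. In each case the following "atoms" clause is required: if $(w,w')\in Z$ then for all $p \in Prop$, $w \in V(p) \Leftrightarrow w' \in V'(p)$. In addition, for all $i \in G$: - $Z$ is a $K$-bisimulation iff: if $(w,w')\in Z$ and $w\sim_i v$, then there is $v'\in W'$ with $(v,v')\in Z$ and $w'\sim'_i v'$; and if $(w,w')\in Z$ and $w'\sim'_i v'$, then there is $v \in W$ with $(v,v')\in Z$ and $w\sim_i v$. - $Z$ is a $B^+$-bisimulation iff: if $(w,w')\in Z$, $w\sim_i v$ and $v\leq_{i,w} w$, then there is $v'\in W'$ with $(v,v')\in Z$, $w'\sim'_i v'$ and $v'\leq'_{i,w'}w'$; and if $(w,w')\in Z$, $w'\sim'_i v'$ and $v'\leq'_{i,w'}w'$, then there is $v\in W$ with $(v,v')\in Z$, $w\sim_i v$ and $v\leq_{i,w}w$. - $Z$ is a $B^c$-bisimulation iff for all formulas $\alpha\in\mathcal{L}(B^c)$: if $(w,w')\in Z$ and $v\in \mathrm{Min}_{\leq_{i,w}}([\![\alpha]\!]^{\mathbb{M}}\cap[w]_{\sim_i})$, then there is $v'\in W'$ with $(v,v')\in Z$ and $v'\in \mathrm{Min}_{\leq'_{i,w'}}([\![\alpha]\!]^{\mathbb{M}'}\cap[w']_{\sim'_i})$; and if $(w,w')\in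 Z$ and $v'\in \mathrm{Min}_{\leq'_{i,w'}}([\![\alpha]\!]^{\mathbb{M}'}\cap[w']_{\sim'_i})$, then there is $v\in W$ with $(v,v')\in Z$ and $v\in \mathrm{Min}_{\leq_{i,w}}([\![\alpha]\!]^{\mathbb{M}}\cap[w]_{\sim_i})$. -}

module Defs where

open import Data.Nat.Base using (ℕ)
open import Data.Product.Base using (_×_; ∃-syntax)
open import Function.Bundles using (_⇔_; _⤖_)
open import Level using (Level; _⊔_; suc)
open import Relation.Binary.Core using (Rel; REL)
open import Relation.Binary.Structures using (IsEquivalence; IsPreorder)
open import Relation.Binary.PropositionalEquality.Core using (_≡_)
open import Relation.Nullary.Negation.Core using (¬_)
open import Relation.Unary using (Pred; _∈_; _∩_; Empty)

-- Non-emptiness is read literally as "≠ ∅", here and in `WellFounded`.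
-- Classically this is the existence of an element.  Demanding an actual
-- minimal element of every non-empty X would let any order with two strictly
-- comparable states decide arbitrary propositions, so that constructively
-- almost nothing would be a model.
NonEmpty : ∀ {a} → Set a → Set a
NonEmpty A = ¬ ¬ A

CountablyInfinite : ∀ {a} → Set a → Set a
CountablyInfinite A = ℕ ⤖ A

module _ {ℓ : Level} {W : Set ℓ} where

  Min : Rel W ℓ → Pred W ℓ → Pred W ℓ
  Min _≤_ X x = x ∈ X × (∀ y → y ∈ X → y ≤ x → x ≤ y)

  -- Not the library's `Induction.WellFounded`, which concerns accessibility
  -- along a strict order and is never satisfied by a reflexive relation on a
  -- non-empty set.
  WellFounded : Rel W ℓ → Set (suc ℓ)
  WellFounded _≤_ = ∀ (X : Pred W ℓ) → ¬ Empty X → ¬ Empty (Min _≤_ X)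

  record IsWellFoundedPreorder (_≤_ : Rel W ℓ) : Set (suc ℓ) where
    field
      isPreorder  : IsPreorder _≡_ _≤_
      wellFounded : WellFounded _≤_

-- States, relations and valuation share one universe level, so that every
-- truth set is among the subsets `Pred W ℓ` that `WellFounded` ranges over.
record Model {g p : Level} (G : Set g) (Letter : Set p) (ℓ : Level)
             : Set (g ⊔ p ⊔ suc ℓ) where
  field
    W        : Set ℓ
    nonEmpty : NonEmpty W
    ∼        : G → Rel W ℓ
    ∼-equiv  : ∀ i → IsEquivalence (∼ i)
    ≤        : G → W → Rel W ℓ
    ≤-wfpre  : ∀ i w → IsWellFoundedPreorder (≤ i w)
    V        : Letter → Pred W ℓ

  _∼[_]_ : W → G → W → Set ℓ
  w ∼[ i ] v = ∼ i w v

  _≤[_,_]_ : W → G → W → W → Set ℓ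
  u ≤[ i , w ] v = ≤ i w u v

  -- the ∼ᵢ-equivalence class of w
  cell : G → W → Pred W ℓ
  cell i w v = w ∼[ i ] v

data 𝓛K {g p : Level} (G : Set g) (Letter : Set p) : Set (g ⊔ p) where
  var  : Letter → 𝓛K G Letter
  ¬′_  : 𝓛K G Letter → 𝓛K G Letter
  _∧′_ : 𝓛K G Letter → 𝓛K G Letter → 𝓛K G Letter
  K    : G → 𝓛K G Letter → 𝓛K G Letter

data 𝓛B⁺ {g p : Level} (G : Set g) (Letter : Set p) : Set (g ⊔ p) where
  var  : Letter → 𝓛B⁺ G Letter
  ¬′_  : 𝓛B⁺ G Letter → 𝓛B⁺ G Letter
  _∧′_ : 𝓛B⁺ G Letter → 𝓛B⁺ G Letter → 𝓛B⁺ G Letter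
  B⁺   : G → 𝓛B⁺ G Letter → 𝓛B⁺ G Letter

-- `Bᶜ i α φ` is B_i^α φ: belief in φ conditional on α.
data 𝓛Bᶜ {g p : Level} (G : Set g) (Letter : Set p) : Set (g ⊔ p) where
  var  : Letter → 𝓛Bᶜ G Letter
  ¬′_  : 𝓛Bᶜ G Letter → 𝓛Bᶜ G Letter
  _∧′_ : 𝓛Bᶜ G Letter → 𝓛Bᶜ G Letter → 𝓛Bᶜ G Letter
  Bᶜ   : G → 𝓛Bᶜ G Letter → 𝓛Bᶜ G Letter → 𝓛Bᶜ G Letter

module _ {g p ℓ : Level} {G : Set g} {Letter : Set p} where
  open Model

  infix 4 _,_⊨K_ _,_⊨B⁺_ _,_⊨Bᶜ_

  _,_⊨K_ : (M : Model G Letter ℓ) → W M → 𝓛K G Letter → Set ℓ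
  M , w ⊨K var q    = w ∈ V M q
  M , w ⊨K (¬′ φ)   = ¬ (M , w ⊨K φ)
  M , w ⊨K (φ ∧′ ψ) = (M , w ⊨K φ) × (M , w ⊨K ψ)
  M , w ⊨K K i φ    = ∀ v → v ∈ cell M i w → M , v ⊨K φ

  _,_⊨B⁺_ : (M : Model G Letter ℓ) → W M → 𝓛B⁺ G Letter → Set ℓ
  M , w ⊨B⁺ var q    = w ∈ V M q
  M , w ⊨B⁺ (¬′ φ)   = ¬ (M , w ⊨B⁺ φ)
  M , w ⊨B⁺ (φ ∧′ ψ) = (M , w ⊨B⁺ φ) × (M , w ⊨B⁺ ψ)
  M , w ⊨B⁺ B⁺ i φ   = ∀ v → v ∈ cell M i w → ≤ M i w v w → M , v ⊨B⁺ φ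

  _,_⊨Bᶜ_ : (M : Model G Letter ℓ) → W M → 𝓛Bᶜ G Letter → Set ℓ
  M , w ⊨Bᶜ var q    = w ∈ V M q
  M , w ⊨Bᶜ (¬′ φ)   = ¬ (M , w ⊨Bᶜ φ)
  M , w ⊨Bᶜ (φ ∧′ ψ) = (M , w ⊨Bᶜ φ) × (M , w ⊨Bᶜ ψ)
  M , w ⊨Bᶜ Bᶜ i α φ =
    ∀ v → v ∈ Min (≤ M i w) ((λ u → M , u ⊨Bᶜ α) ∩ cell M i w) → M , v ⊨Bᶜ φ

  ⟦_⟧ : 𝓛Bᶜ G Letter → (M : Model G Letter ℓ) → Pred (W M) ℓ
  ⟦ α ⟧ M = λ w → M , w ⊨Bᶜ α

module _ {g p ℓ ℓ′ z : Level} {G : Set g} {Letter : Set p}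
         (M : Model G Letter ℓ) (M′ : Model G Letter ℓ′)
         (Z : REL (Model.W M) (Model.W M′) z) where
  open Model M
  open Model M′ using () renaming
    (≤ to ≤′; V to V′; _∼[_]_ to _∼′[_]_; _≤[_,_]_ to _≤′[_,_]_; cell to cell′)

  Atoms : Set (p ⊔ ℓ ⊔ ℓ′ ⊔ z)
  Atoms = ∀ {w w′} → Z w w′ → ∀ q → (w ∈ V q) ⇔ (w′ ∈ V′ q)

  record IsKBisimulation : Set (g ⊔ p ⊔ ℓ ⊔ ℓ′ ⊔ z) where
    field
      atoms : Atoms
      forth : ∀ i {w w′ v} → Z w w′ → w ∼[ i ] v →
              ∃[ v′ ] (Z v v′ × w′ ∼′[ i ] v′)
      back  : ∀ i {w w′ v′} → Z w w′ → w′ ∼′[ i ] v′ →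
              ∃[ v ] (Z v v′ × w ∼[ i ] v)

  record IsB⁺Bisimulation : Set (g ⊔ p ⊔ ℓ ⊔ ℓ′ ⊔ z) where
    field
      atoms : Atoms
      forth : ∀ i {w w′ v} → Z w w′ → w ∼[ i ] v → v ≤[ i , w ] w →
              ∃[ v′ ] (Z v v′ × w′ ∼′[ i ] v′ × v′ ≤′[ i , w′ ] w′)
      back  : ∀ i {w w′ v′} → Z w w′ → w′ ∼′[ i ] v′ → v′ ≤′[ i , w′ ] w′ →
              ∃[ v ] (Z v v′ × w ∼[ i ] v × v ≤[ i , w ] w)

  record IsBᶜBisimulation : Set (g ⊔ p ⊔ ℓ ⊔ ℓ′ ⊔ z) where
    field
      atoms : Atoms
      forth : ∀ i α {w w′ v} → Z w w′ → v ∈ Min (≤ i w) (⟦ α ⟧ M ∩ cell i w) →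
              ∃[ v′ ] (Z v v′ × v′ ∈ Min (≤′ i w′) (⟦ α ⟧ M′ ∩ cell′ i w′))
      back  : ∀ i α {w w′ v′} → Z w w′ → v′ ∈ Min (≤′ i w′) (⟦ α ⟧ M′ ∩ cell′ i w′) →
              ∃[ v ] (Z v v′ × v ∈ Min (≤ i w) (⟦ α ⟧ M ∩ cell i w))

{-# OPTIONS --safe #-}
module Submission where

open import Defs
open import Data.Product.Base using (_×_; _,_; ∃-syntax)
open import Data.Product.Function.NonDependent.Propositional using (_×-⇔_)
open import Function.Bundles using (_⇔_; mk⇔; Equivalence)
open import Function.Related.TypeIsomorphisms using (¬-cong-⇔)
open import Level using (Level)
open import Relation.Binary.Core using (REL)
open import Relation.Unary using (Pred)

open Equivalence using (to; from)

-- Induction on the formula, for all `Z`-linked pairs at once. Letters are settled by the atoms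
-- clause, and Booleans because connectives respect equivalence. Each modality says that a formula
-- holds throughout a set of states fixed by the current point: its cell, the states of the cell at
-- most as high as the point, or the minimal `α`-states of the cell. The back and forth clauses say
-- that `Z` matches these sets in both directions, and `□-cong-⇔` turns such a matching into
-- equivalence of the boxed formulas.

private
  variable
    a b g p ℓ ℓ′ r r′ z : Level

-- The directions cross over: a claim about an arbitrary `v′` in `R′` is proved by pulling `v′` back
-- to a linked `v` in `R`, so passing from `P` to `P′` uses back, and the converse uses forth.
□-cong-⇔ : {W : Set a} {W′ : Set b} {Z : REL W W′ z}
           {R : Pred W r} {R′ : Pred W′ r′} {P : Pred W ℓ} {P′ : Pred W′ ℓ′} →
           (∀ {v} → R v → ∃[ v′ ] (Z v v′ × R′ v′)) →
           (∀ {v′} → R′ v′ → ∃[ v ] (Z v v′ × R v)) →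
           (∀ v v′ → Z v v′ → P v ⇔ P′ v′) →
           (∀ v → R v → P v) ⇔ (∀ v′ → R′ v′ → P′ v′)
□-cong-⇔ forth back P⇔P′ = mk⇔
  (λ □P v′ r′ → let v , vZv′ , r = back r′ in to (P⇔P′ v v′ vZv′) (□P v r))
  (λ □P′ v r → let v′ , vZv′ , r′ = forth r in from (P⇔P′ v v′ vZv′) (□P′ v′ r′))

module _ {G : Set g} {Letter : Set p}
         (M : Model G Letter ℓ) (M′ : Model G Letter ℓ′)
         (Z : REL (Model.W M) (Model.W M′) z) where

  K-invariance : IsKBisimulation M M′ Z → ∀ (φ : 𝓛K G Letter) w w′ → Z w w′ →
                 (M , w ⊨K φ) ⇔ (M′ , w′ ⊨K φ)
  K-invariance bisim = go
    where
    open IsKBisimulation bisim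
    go : ∀ φ w w′ → Z w w′ → (M , w ⊨K φ) ⇔ (M′ , w′ ⊨K φ)
    go (var q)  w w′ wZw′ = atoms wZw′ q
    go (¬′ φ)   w w′ wZw′ = ¬-cong-⇔ (go φ w w′ wZw′)
    go (φ ∧′ ψ) w w′ wZw′ = go φ w w′ wZw′ ×-⇔ go ψ w w′ wZw′
    -- The matched states may differ from `w` and `w′`, so the induction hypothesis is passed on for
    -- all linked pairs.
    go (K i φ)  w w′ wZw′ = □-cong-⇔ (forth i wZw′) (back i wZw′) (go φ)

  B⁺-invariance : IsB⁺Bisimulation M M′ Z → ∀ (φ : 𝓛B⁺ G Letter) w w′ → Z w w′ →
                  (M , w ⊨B⁺ φ) ⇔ (M′ , w′ ⊨B⁺ φ)
  B⁺-invariance bisim = go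
    where
    open IsB⁺Bisimulation bisim
    go : ∀ φ w w′ → Z w w′ → (M , w ⊨B⁺ φ) ⇔ (M′ , w′ ⊨B⁺ φ)
    go (var q)  w w′ wZw′ = atoms wZw′ q
    go (¬′ φ)   w w′ wZw′ = ¬-cong-⇔ (go φ w w′ wZw′)
    go (φ ∧′ ψ) w w′ wZw′ = go φ w w′ wZw′ ×-⇔ go ψ w w′ wZw′
    -- The argument of `□-cong-⇔` again, written out because the range of the box is given by two
    -- curried conditions instead of one predicate.
    go (B⁺ i φ) w w′ wZw′ = mk⇔
      (λ □φ v′ w∼v′ v′≤w′ → let v , vZv′ , w∼v , v≤w = back i wZw′ w∼v′ v′≤w′ in
        to (go φ v v′ vZv′) (□φ v w∼v v≤w))
      (λ □φ v w∼v v≤w → let v′ , vZv′ , w∼v′ , v′≤w′ = forth i wZw′ w∼v v≤w in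
        from (go φ v v′ vZv′) (□φ v′ w∼v′ v′≤w′))

  -- Bᶜ-bisimulations range over all formulas α, each interpreted in its own
  -- model, so invariance of the condition α is never needed.
  Bᶜ-invariance : IsBᶜBisimulation M M′ Z → ∀ (φ : 𝓛Bᶜ G Letter) w w′ → Z w w′ →
                  (M , w ⊨Bᶜ φ) ⇔ (M′ , w′ ⊨Bᶜ φ)
  Bᶜ-invariance bisim = go
    where
    open IsBᶜBisimulation bisim
    go : ∀ φ w w′ → Z w w′ → (M , w ⊨Bᶜ φ) ⇔ (M′ , w′ ⊨Bᶜ φ)
    go (var q)    w w′ wZw′ = atoms wZw′ q
    go (¬′ φ)     w w′ wZw′ = ¬-cong-⇔ (go φ w w′ wZw′)
    go (φ ∧′ ψ)   w w′ wZw′ = go φ w w′ wZw′ ×-⇔ go ψ w w′ wZw′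
    go (Bᶜ i α φ) w w′ wZw′ = □-cong-⇔ (forth i α wZw′) (back i α wZw′) (go φ)

theorem9 : ∀ {g p ℓ ℓ′ z} (G : Set g) (Letter : Set p) →
    NonEmpty G → CountablyInfinite Letter →
    (M : Model G Letter ℓ) (M′ : Model G Letter ℓ′)
    (Z : REL (Model.W M) (Model.W M′) z) →
    (IsKBisimulation M M′ Z →
    ∀ (φ : 𝓛K G Letter) w w′ → Z w w′ → (M , w ⊨K φ) ⇔ (M′ , w′ ⊨K φ))
    × (IsB⁺Bisimulation M M′ Z →
    ∀ (φ : 𝓛B⁺ G Letter) w w′ → Z w w′ → (M , w ⊨B⁺ φ) ⇔ (M′ , w′ ⊨B⁺ φ))
    × (IsBᶜBisimulation M M′ Z →
    ∀ (φ : 𝓛Bᶜ G Letter) w w′ → Z w w′ → (M , w ⊨Bᶜ φ) ⇔ (M′ , w′ ⊨Bᶜ φ))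
theorem9 G Letter _ _ M M′ Z =
  K-invariance M M′ Z , B⁺-invariance M M′ Z , Bᶜ-invariance M M′ Z
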